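{- There exists an elliptic curve $E$ defined over $\mathbf{Q}$ with $S_{x,y}(E) \geq 5$; that is, there exist an elliptic curve $E/\mathbf{Q}$ and five distinct rational points $P_1,\dots,P_5 \in E(\mathbf{Q})$ such that their $x$-coordinates, in some order, form an arithmetic progression with nonzero common difference, and their $y$-coordinates, in some (possibly different) order, also form an arithmetic progression with nonzero common difference.
   Context: An elliptic curve over $\mathbf{Q}$ is given by a general Weierstrass equation $Y^2 + a_1XY + a_3Y = X^3 + a_2X^2 + a_4X + a_6$ with $a_i \in \mathbf{Q}$ and nonzero discriminant. Rational points $P_0,\dots,P_n\in E$ form a simultaneous arithmetic progression if their $x$-coordinates form an arithmetic progression (with nonzero difference) in some order and their $y$-coordinates form an arithmetic progression (with nonzero difference) in some, possibly different, order. $S_{x,y}(E)$ denotes the maximal number of rational points of $E$ forming a simultaneous arithmetic progression. -}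

module Defs where

open import Agda.Builtin.FromNat using (Number; fromNat)
open import Data.Fin.Base using (Fin; toℕ)
open import Data.Fin.Permutation using (Permutation′; _⟨$⟩ʳ_)
open import Data.Integer.Base using (+_)
open import Data.Nat.Base using (ℕ)
open import Data.Product.Base using (∃-syntax; Σ-syntax; _×_)
open import Data.Rational.Base using (ℚ; 0ℚ; _+_; _*_; _-_; -_)
open import Data.Rational.Literals using (fromℤ; number)
open import Data.Unit.Base using (tt)
open import Data.Vec.Functional using (Vector)
open import Function.Base using (_∘_)
open import Relation.Binary.PropositionalEquality.Core using (_≡_; _≢_)

private instance
  ℚ-number : Number ℚ
  ℚ-number = number

record Weierstrass : Set where
  field
    a₁ a₂ a₃ a₄ a₆ : ℚ

  b₂ b₄ b₆ b₈ : ℚ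
  b₂ = a₁ * a₁ + 4 * a₂
  b₄ = 2 * a₄ + a₁ * a₃
  b₆ = a₃ * a₃ + 4 * a₆
  b₈ = a₁ * a₁ * a₆ + 4 * a₂ * a₆ - a₁ * a₃ * a₄ + a₂ * a₃ * a₃ - a₄ * a₄

  Δ : ℚ
  Δ = - (b₂ * b₂ * b₈) - 8 * b₄ * b₄ * b₄ - 27 * b₆ * b₆ + 9 * b₂ * b₄ * b₆

record EllipticCurve : Set where
  field
    weierstrass : Weierstrass
  open Weierstrass weierstrass public
  field
    Δ≢0 : Δ ≢ 0ℚ

-- Only affine rational points: the point at infinity has no x- or
-- y-coordinate, so it never belongs to a simultaneous progression.
record Point (E : EllipticCurve) : Set where
  open EllipticCurve E
  field
    x y : ℚ
    onCurve : y * y + a₁ * x * y + a₃ * y ≡ x * x * x + a₂ * x * x + a₄ * x + a₆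

open Point public using (x; y)

IsAP : ∀ {n} → Vector ℚ n → Set
IsAP {n} f = ∃[ a ] ∃[ d ] d ≢ 0ℚ × (∀ (i : Fin n) → f i ≡ a + fromℤ (+ toℕ i) * d)

IsAPInSomeOrder : ∀ {n} → Vector ℚ n → Set
IsAPInSomeOrder {n} f = Σ[ π ∈ Permutation′ n ] IsAP (f ∘ (π ⟨$⟩ʳ_))

IsSimultaneousAP : ∀ {E n} → Vector (Point E) n → Set
IsSimultaneousAP P = IsAPInSomeOrder (x ∘ P) × IsAPInSomeOrder (y ∘ P)

{-# OPTIONS --safe #-}
-- For any permutation σ, the polynomials in the span of y², xy, y, x³, x², x, 1
-- that vanish at the five points (i , σ i) form a space of dimension at least
-- two; after rescaling x and y, those with nonzero y² and x³ coefficients are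
-- Weierstrass equations.  For σ = (1 2) one of them is, up to an affine change
-- of x and y, y² − 5xy − 2y = x³ − x², of discriminant 892, with the points
-- (−4,−8), (−3,−4), (−2,−6), (−1,−2), (0,0).
module Submission where

open import Defs
open import Data.Fin.Base using (Fin; toℕ)
open import Data.Fin.Patterns using (1F; 2F)
open import Data.Fin.Permutation as Permutation using (Permutation′; _⟨$⟩ʳ_; transpose)
import Data.Fin.Properties as Fin
open import Data.Integer.Base using (+_; -[1+_])
open import Data.Product.Base using (Σ-syntax; _×_; _,_)
open import Data.Rational.Base using (ℚ; 0ℚ; 1ℚ; _+_; _*_)
open import Data.Rational.Literals using (fromℤ)
open import Data.Rational.Properties using (_≟_)
open import Data.Vec.Functional using (Vector)
open import Function.Base using (_∘_)
open import Function.Definitions using (Injective)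
open import Relation.Binary.PropositionalEquality.Core using (_≡_; _≢_; cong)
open import Relation.Nullary.Decidable using (from-yes; from-no; _→-dec_)

curve : EllipticCurve
curve = record
  { weierstrass = weierstrass
  ; Δ≢0 = from-no (Weierstrass.Δ weierstrass ≟ 0ℚ)
  }
  where
  weierstrass : Weierstrass
  weierstrass = record
    { a₁ = fromℤ -[1+ 4 ]
    ; a₂ = fromℤ -[1+ 0 ]
    ; a₃ = fromℤ -[1+ 1 ]
    ; a₄ = 0ℚ
    ; a₆ = 0ℚ
    }

arithmeticProgression : ∀ {n} → ℚ → ℚ → Vector ℚ n
arithmeticProgression a d i = a + fromℤ (+ toℕ i) * d

-- Reordering by the inverse of `π` undoes the shuffle, leaving the progression in the literal form
-- that `IsAP` asks for.
arithmeticProgression-isAPInSomeOrder : ∀ {n d} (π : Permutation′ n) a → d ≢ 0ℚ →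
  IsAPInSomeOrder (arithmeticProgression a d ∘ (π ⟨$⟩ʳ_))
arithmeticProgression-isAPInSomeOrder {d = d} π a d≢0 =
  Permutation.flip π , a , d , d≢0 , λ _ →
    cong (arithmeticProgression a d) (Permutation.inverseʳ π)

σ : Permutation′ 5
σ = transpose 1F 2F

xs ys : Vector ℚ 5
xs = arithmeticProgression (fromℤ -[1+ 3 ]) 1ℚ
ys = arithmeticProgression (fromℤ -[1+ 7 ]) (fromℤ (+ 2)) ∘ (σ ⟨$⟩ʳ_)

points : Vector (Point curve) 5
points i = record { x = xs i ; y = ys i ; onCurve = onCurve i }
  where
  open EllipticCurve curve
  -- Only five closed rational equations, so evaluation decides them.
  onCurve = from-yes (Fin.all? λ i → let x = xs i; y = ys i in
    y * y + a₁ * x * y + a₃ * y ≟ x * x * x + a₂ * x * x + a₄ * x + a₆)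

-- Separates the points: equal points would share an x-coordinate.
xs-injective : ∀ i j → xs i ≡ xs j → i ≡ j
xs-injective = from-yes (Fin.all? λ i → Fin.all? λ j →
  (xs i ≟ xs j) →-dec (i Fin.≟ j))

theorem2 : Σ[ E ∈ EllipticCurve ] Σ[ P ∈ Vector (Point E) 5 ] (Injective _≡_ _≡_ P × IsSimultaneousAP P)
theorem2 = curve , points , (λ {i} {j} Pi≡Pj → xs-injective i j (cong x Pi≡Pj))
  -- The x-coordinates are already in order; only the y-coordinates need `σ`.
  , arithmeticProgression-isAPInSomeOrder Permutation.id (fromℤ -[1+ 3 ]) (from-no (1ℚ ≟ 0ℚ))
  , arithmeticProgression-isAPInSomeOrder σ (fromℤ -[1+ 7 ]) (from-no (fromℤ (+ 2) ≟ 0ℚ))
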